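{- Let $G$ and $H$ be graphs, and let $k\ge 1$ be an integer. Then $$\left\lceil \frac{n(G)\,n(H)}{k+1}\right\rceil\le \gamma_k^{\mathrm L}(G\square H)\le \min\big\{\gamma_k^{\mathrm L}(G)\,n(H),\ \gamma_k^{\mathrm L}(H)\,n(G)\big\}.$$
   Context: All graphs are finite and simple; $n(G)=|V(G)|$, and $N_G(u)$ is the open neighborhood of $u$ in $G$. A set $D\subseteq V(G)$ is a dominating set if every vertex of $V(G)\setminus D$ has a neighbor in $D$. For an integer $k\ge 0$, a dominating set $D$ of $G$ is a $k$-limited dominating set if $|N_G(u)\setminus D|\le k$ for every $u\in D$. The $k$-limited domination number $\gamma_k^{\mathrm L}(G)$ is the minimum cardinality of a $k$-limited dominating set of $G$ (defined for all integers $k\ge 0$, including $k\ge\Delta(G)$). The Cartesian product $G\square H$ has vertex set $V(G)\times V(H)$, with $(g,h)$ and $(g',h')$ adjacent if and only if either $g=g'$ and $hh'\in E(H)$, or $h=h'$ and $gg'\in E(G)$. -}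

module Defs where

open import Data.Fin.Base using (Fin)
open import Data.Fin.Properties using (any?; all?; *↔×)
import Data.Fin.Properties as Fin
open import Data.Fin.Subset using (Subset; ⊤; _─_; ∣_∣)
import Data.Fin.Subset as Subset
open import Data.Fin.Subset.Properties using (∈⊤; p─⊤≡⊥; ∣⊥∣≡0; anySubset?)
import Data.Fin.Subset.Properties as Subsetₚ
open import Data.Nat.Base using (ℕ; zero; suc; _*_; _≤_; z≤n; s≤s)
open import Data.Nat.Properties using (_≤?_; _≟_)
open import Data.Product.Base using (∃; _×_; _,_; proj₁; proj₂)
open import Data.Product.Function.NonDependent.Propositional using (_×-↔_)
open import Data.Sum.Base using (_⊎_; inj₁; inj₂)
import Data.Sum.Base as Sum
open import Data.Vec.Base using (tabulate)
open import Function.Base using (_∘_)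
open import Function.Bundles using (_↔_; Inverse)
open import Function.Properties.Inverse using (↔-sym; ↔-trans; ↔⇒↣)
open import Level using (0ℓ)
open import Relation.Binary.Core using (Rel)
open import Relation.Binary.Definitions
  using (DecidableEquality; Irreflexive; Symmetric)
import Relation.Binary.Definitions as Binary
open import Relation.Binary.PropositionalEquality
  using (_≡_; refl; sym; cong; subst; trans)
open import Relation.Nullary.Decidable
  using (Dec; yes; no; does; map′; ¬?; _×-dec_; _⊎-dec_; _→-dec_; via-injection)
open import Relation.Nullary.Negation using (¬_; contradiction)
open import Relation.Unary using (Pred; Decidable)

-- Finite simple graphs.  Over a finite vertex set adjacency is classically
-- always decidable; constructively this has to be part of the data.
record Graph : Set₁ where
  infix 4 _~_ _~?_
  field
    Vertex   : Set
    order    : ℕ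
    enum     : Vertex ↔ Fin order
    _~_      : Rel Vertex 0ℓ
    _~?_     : Binary.Decidable _~_
    ~-sym    : Symmetric _~_
    ~-irrefl : Irreflexive _≡_ _~_

  index : Vertex → Fin order
  index = Inverse.to enum

  vertex : Fin order → Vertex
  vertex = Inverse.from enum

  vertex-index : ∀ v → vertex (index v) ≡ v
  vertex-index = Inverse.strictlyInverseʳ enum

  _≟ᵛ_ : DecidableEquality Vertex
  _≟ᵛ_ = via-injection (↔⇒↣ enum) Fin._≟_

  -- Sets of vertices are represented by the corresponding sets of indices.
  VertexSet : Set
  VertexSet = Subset order

  infix 4 _∈_ _∉_ _∈?_

  _∈_ : Vertex → VertexSet → Set
  v ∈ D = index v Subset.∈ D

  _∉_ : Vertex → VertexSet → Set
  v ∉ D = ¬ (v ∈ D)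

  _∈?_ : Binary.Decidable _∈_
  v ∈? D = index v Subsetₚ.∈? D

  N : Vertex → VertexSet
  N u = tabulate (λ i → does (u ~? vertex i))

  any-vertex? : {P : Pred Vertex 0ℓ} → Decidable P → Dec (∃ P)
  any-vertex? {P} P? = map′
    (λ (i , p) → vertex i , p)
    (λ (v , p) → index v , subst P (sym (vertex-index v)) p)
    (any? (P? ∘ vertex))

  all-vertices? : {P : Pred Vertex 0ℓ} → Decidable P → Dec (∀ v → P v)
  all-vertices? {P} P? = map′
    (λ p v → subst P (vertex-index v) (p (index v)))
    (λ p i → p (vertex i))
    (all? (P? ∘ vertex))

open Graph public using (order)

module _ (G : Graph) where
  open Graph G hiding (order)

  Dominating : VertexSet → Set
  Dominating D = ∀ v → v ∉ D → ∃ λ u → u ∈ D × v ~ u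

  LimitedDominating : ℕ → VertexSet → Set
  LimitedDominating k D = Dominating D × (∀ u → u ∈ D → ∣ N u ─ D ∣ ≤ k)

  limitedDominating? : ∀ k → Decidable (LimitedDominating k)
  limitedDominating? k D =
    all-vertices? (λ v → ¬? (v ∈? D) →-dec any-vertex? (λ u → (u ∈? D) ×-dec (v ~? u)))
      ×-dec
    all-vertices? (λ u → (u ∈? D) →-dec (∣ N u ─ D ∣ ≤? k))

  ⊤-limitedDominating : ∀ k → LimitedDominating k ⊤
  ⊤-limitedDominating k =
      (λ v v∉⊤ → contradiction ∈⊤ v∉⊤)
    , (λ u _ → subst (_≤ k) (sym (trans (cong ∣_∣ (p─⊤≡⊥ (N u))) (∣⊥∣≡0 (order G)))) z≤n)

least : {P : Pred ℕ 0ℓ} → Decidable P → ∃ P → ∃ λ m → P m × (∀ n → P n → m ≤ n)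
least {P} P? (n , p) = go P? n p
  where
  go : {Q : Pred ℕ 0ℓ} → Decidable Q → ∀ n → Q n →
       ∃ λ m → Q m × (∀ n → Q n → m ≤ n)
  go Q? zero    q = zero , q , λ _ _ → z≤n
  go Q? (suc n) q with Q? zero
  ... | yes q₀ = zero , q₀ , λ _ _ → z≤n
  ... | no ¬q₀ with go (Q? ∘ suc) n q
  ...   | m , qm , min = suc m , qm , λ
    { zero    q₀ → contradiction q₀ ¬q₀
    ; (suc n) qn → s≤s (min n qn)
    }

minimumLimitedDominating : ∀ k (G : Graph) →
  ∃ λ m → (∃ λ D → LimitedDominating G k D × ∣ D ∣ ≡ m)
        × (∀ D → LimitedDominating G k D → m ≤ ∣ D ∣)
minimumLimitedDominating k G
  with least (λ m → anySubset? (λ D → limitedDominating? G k D ×-dec (∣ D ∣ ≟ m)))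
             (∣ ⊤ {order G} ∣ , ⊤ , ⊤-limitedDominating G k , refl)
... | m , attained , min = m , attained , λ D ld → min ∣ D ∣ (D , ld , refl)

-- The k-limited domination number.
γᴸ : ℕ → Graph → ℕ
γᴸ k G = proj₁ (minimumLimitedDominating k G)

infixr 7 _□_

_□_ : Graph → Graph → Graph
G □ H = record
  { Vertex   = G.Vertex × H.Vertex
  ; order    = G.order * H.order
  ; enum     = ↔-trans (G.enum ×-↔ H.enum) (↔-sym *↔×)
  ; _~_      = λ (g , h) (g′ , h′) → (g ≡ g′ × h H.~ h′) ⊎ (h ≡ h′ × g G.~ g′)
  ; _~?_     = λ (g , h) (g′ , h′) →
                 ((g G.≟ᵛ g′) ×-dec (h H.~? h′)) ⊎-dec ((h H.≟ᵛ h′) ×-dec (g G.~? g′))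
  ; ~-sym    = Sum.map (λ (e , a) → sym e , H.~-sym a) (λ (e , a) → sym e , G.~-sym a)
  ; ~-irrefl = λ { refl (inj₁ (_ , a)) → H.~-irrefl refl a
                 ; refl (inj₂ (_ , a)) → G.~-irrefl refl a }
  }
  where
  module G = Graph G
  module H = Graph H

{-# OPTIONS --safe #-}
-- Lower bound: D is dominating, so the sets {u} ∪ (N u ─ D), u ∈ D, cover the
-- graph, and k-limitedness bounds each of them by k + 1.
-- Upper bound: if D is k-limited dominating in G, then so is D × V(H) in G □ H,
-- because a neighbour of (g , h) outside D × V(H) must lie in the G-layer of h.
module Submission where

open import Defs
open import Data.Nat.Base using (ℕ; suc; _*_; _≤_; _⊓_)
open import Data.Integer.Base using (+_) renaming (_≤_ to _≤ᶻ_)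
open import Data.Rational.Unnormalised.Base using (_/_; ceiling)
open import Data.Product.Base using (_×_)

open import Data.Bool.Base using (true)
open import Data.Fin.Base using (Fin)
open import Data.Fin.Subset
  using (Subset; inside; outside; ⊤; ⊥; ⁅_⁆; _∪_; _─_; ∣_∣)
  renaming (_∈_ to _∈ˢ_; _∉_ to _∉ˢ_)
open import Data.Fin.Subset.Properties
  using ( ∈⊤; ∣⊤∣≡n; ∣⊥∣≡0; x∈⁅x⁆; ∣⁅x⁆∣≡1; x∈p∪q⁺; p⊆q⇒∣p∣≤∣q∣
        ; x∈p∧x∉q⇒x∈p─q; p─q⊆p )
import Data.Integer.Base as ℤ
import Data.Integer.DivMod as ℤ
import Data.Integer.Properties as ℤ
import Data.Nat.Base as ℕ
import Data.Nat.Properties as ℕ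
open import Data.Product.Algebra using (×-comm)
open import Data.Product.Base using (∃; _,_; proj₁; proj₂)
open import Data.Sum.Base using (inj₁; inj₂; swap)
open import Data.Vec.Base using ([]; _∷_; here; there; tabulate)
open import Data.Vec.Properties using (lookup⇒[]=; []=⇒lookup; lookup∘tabulate)
open import Function.Base using (_∘_; id)
open import Function.Bundles using (_↔_; _⇔_; mk⇔; Inverse; Equivalence)
open import Function.Properties.Inverse using (↔-refl)
open import Level using (0ℓ)
open import Relation.Binary.PropositionalEquality
  using (_≡_; refl; sym; cong; subst; trans)
open import Relation.Nullary.Decidable using (Dec; yes; no; does; dec-true)
open import Relation.Nullary.Negation using (contradiction)
open import Relation.Unary using (Pred; Decidable)

-- Cardinality of subsets and of indexed unions.

does⁻ : {A : Set} (a? : Dec A) → does a? ≡ true → A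
does⁻ (yes a) _ = a

x∈p─q⇒x∉q : ∀ {n} {x : Fin n} (p q : Subset n) → x ∈ˢ p ─ q → x ∉ˢ q
x∈p─q⇒x∉q (_ ∷ p) (inside  ∷ q) (there x∈) (there x∈q) = x∈p─q⇒x∉q p q x∈ x∈q
x∈p─q⇒x∉q (_ ∷ p) (outside ∷ q) (there x∈) (there x∈q) = x∈p─q⇒x∉q p q x∈ x∈q

∣p∪q∣≤∣p∣+∣q∣ : ∀ {n} (p q : Subset n) → ∣ p ∪ q ∣ ≤ ∣ p ∣ ℕ.+ ∣ q ∣
∣p∪q∣≤∣p∣+∣q∣ []            []            = ℕ.z≤n
∣p∪q∣≤∣p∣+∣q∣ (outside ∷ p) (outside ∷ q) = ∣p∪q∣≤∣p∣+∣q∣ p q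
∣p∪q∣≤∣p∣+∣q∣ (outside ∷ p) (inside  ∷ q) =
  ℕ.≤-trans (ℕ.s≤s (∣p∪q∣≤∣p∣+∣q∣ p q)) (ℕ.≤-reflexive (sym (ℕ.+-suc ∣ p ∣ ∣ q ∣)))
∣p∪q∣≤∣p∣+∣q∣ (inside  ∷ p) (outside ∷ q) = ℕ.s≤s (∣p∪q∣≤∣p∣+∣q∣ p q)
∣p∪q∣≤∣p∣+∣q∣ (inside  ∷ p) (inside  ∷ q) =
  ℕ.s≤s (ℕ.≤-trans (∣p∪q∣≤∣p∣+∣q∣ p q) (ℕ.+-monoʳ-≤ ∣ p ∣ (ℕ.n≤1+n ∣ q ∣)))

-- Recursion on `p` lets only the sets indexed by members of `p` enter the union, so a size bound
-- counts `∣ p ∣` sets and not `m`.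
⋃[_]_ : ∀ {m n} → Subset m → (Fin m → Subset n) → Subset n
⋃[ []          ] F = ⊥
⋃[ inside  ∷ p ] F = F Fin.zero ∪ (⋃[ p ] (F ∘ Fin.suc))
⋃[ outside ∷ p ] F = ⋃[ p ] (F ∘ Fin.suc)

x∈⋃⁺ : ∀ {m n} {p : Subset m} (F : Fin m → Subset n) {i x} →
       i ∈ˢ p → x ∈ˢ F i → x ∈ˢ ⋃[ p ] F
x∈⋃⁺ {p = inside  ∷ p} F here        x∈ = x∈p∪q⁺ (inj₁ x∈)
x∈⋃⁺ {p = inside  ∷ p} F (there i∈p) x∈ = x∈p∪q⁺ (inj₂ (x∈⋃⁺ (F ∘ Fin.suc) i∈p x∈))
x∈⋃⁺ {p = outside ∷ p} F (there i∈p) x∈ = x∈⋃⁺ (F ∘ Fin.suc) i∈p x∈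

∣⋃∣≤ : ∀ {m n c} (p : Subset m) (F : Fin m → Subset n) →
       (∀ i → i ∈ˢ p → ∣ F i ∣ ≤ c) → ∣ ⋃[ p ] F ∣ ≤ ∣ p ∣ * c
∣⋃∣≤ {n = n} []      F F≤c = ℕ.≤-reflexive (∣⊥∣≡0 n)
∣⋃∣≤ (inside  ∷ p) F F≤c =
  ℕ.≤-trans (∣p∪q∣≤∣p∣+∣q∣ (F Fin.zero) _)
    (ℕ.+-mono-≤ (F≤c Fin.zero here)
                (∣⋃∣≤ p (F ∘ Fin.suc) (λ i → F≤c (Fin.suc i) ∘ there)))
∣⋃∣≤ (outside ∷ p) F F≤c = ∣⋃∣≤ p (F ∘ Fin.suc) (λ i → F≤c (Fin.suc i) ∘ there)

-- Vertex sets given by decidable predicates, and counting by covers.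

module _ (G : Graph) where
  open Graph G hiding (order)

  index-vertex : ∀ i → index (vertex i) ≡ i
  index-vertex = Inverse.strictlyInverseˡ enum

  ∈-vertex⁺ : ∀ {i} (D : VertexSet) → i ∈ˢ D → vertex i ∈ D
  ∈-vertex⁺ D = subst (_∈ˢ D) (sym (index-vertex _))

  ∈-vertex⁻ : ∀ {i} (D : VertexSet) → vertex i ∈ D → i ∈ˢ D
  ∈-vertex⁻ D = subst (_∈ˢ D) (index-vertex _)

  module _ {P : Pred Vertex 0ℓ} (P? : Decidable P) where

    -- Has the same shape as `N`, so `N u` is definitionally the `setOf` of `u ~?_` and the two
    -- membership lemmas below also serve neighbourhoods.
    setOf : VertexSet
    setOf = tabulate (λ i → does (P? (vertex i)))

    ∈-setOf⁺ : ∀ {v} → P v → v ∈ setOf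
    ∈-setOf⁺ {v} Pv = lookup⇒[]= (index v) setOf
      (trans (lookup∘tabulate _ (index v))
             (dec-true (P? _) (subst P (sym (vertex-index v)) Pv)))

    ∈-setOf⁻ : ∀ {v} → v ∈ setOf → P v
    ∈-setOf⁻ {v} v∈ = subst P (vertex-index v)
      (does⁻ (P? _) (trans (sym (lookup∘tabulate _ (index v))) ([]=⇒lookup v∈)))

module _ (G H : Graph) where
  private
    module G = Graph G
    module H = Graph H

  -- The union bound, transported from indices to vertices. `D` and `S` may lie in different graphs,
  -- so that sets in a product can be compared with sets in a factor.
  ∣∣-cover : ∀ {c} (D : G.VertexSet) (S : H.VertexSet) (F : G.Vertex → H.VertexSet) →
             (∀ v → v H.∈ S → ∃ λ u → u G.∈ D × v H.∈ F u) →
             (∀ u → u G.∈ D → ∣ F u ∣ ≤ c) →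
             ∣ S ∣ ≤ ∣ D ∣ * c
  ∣∣-cover D S F cover F≤c = ℕ.≤-trans
    (p⊆q⇒∣p∣≤∣q∣ λ {x} x∈S → let u , u∈D , x∈Fu = cover (H.vertex x) (∈-vertex⁺ H S x∈S) in
      x∈⋃⁺ (F ∘ G.vertex) u∈D
        (subst (λ w → x ∈ˢ F w) (sym (G.vertex-index u)) (∈-vertex⁻ H (F u) x∈Fu)))
    (∣⋃∣≤ D (F ∘ G.vertex) (λ i → F≤c (G.vertex i) ∘ ∈-vertex⁺ G D))

  -- The singletons of `f u` with `u ∈ D` cover `S`, so the union bound applies with `c = 1`.
  ∣∣-image : (D : G.VertexSet) (S : H.VertexSet) (f : G.Vertex → H.Vertex) →
             (∀ v → v H.∈ S → ∃ λ u → u G.∈ D × f u ≡ v) →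
             ∣ S ∣ ≤ ∣ D ∣
  ∣∣-image D S f onto = subst (∣ S ∣ ≤_) (ℕ.*-identityʳ ∣ D ∣)
    (∣∣-cover D S (λ u → ⁅ H.index (f u) ⁆)
      (λ v v∈S → let u , u∈D , fu≡v = onto v v∈S in
        u , u∈D , subst (λ w → v H.∈ ⁅ H.index w ⁆) (sym fu≡v) (x∈⁅x⁆ (H.index v)))
      (λ u _ → ℕ.≤-reflexive (∣⁅x⁆∣≡1 (H.index (f u)))))

-- The lower bound.

order≤∣D∣*suc-k : ∀ (G : Graph) k D → LimitedDominating G k D → order G ≤ ∣ D ∣ * suc k
order≤∣D∣*suc-k G k D (dominating , limited) = subst (_≤ ∣ D ∣ * suc k) (∣⊤∣≡n (order G))
  (∣∣-cover G G D ⊤ closedN covered bounded)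
  where
  open Graph G hiding (order)

  closedN : Vertex → VertexSet
  closedN u = ⁅ index u ⁆ ∪ (N u ─ D)

  covered : ∀ v → v ∈ ⊤ → ∃ λ u → u ∈ D × v ∈ closedN u
  covered v _ with v ∈? D
  ... | yes v∈D = v , v∈D , x∈p∪q⁺ (inj₁ (x∈⁅x⁆ (index v)))
  ... | no  v∉D = let u , u∈D , v~u = dominating v v∉D in
    -- Domination yields `v ~ u`, while membership in `N u` asks for `u ~ v`.
    u , u∈D , x∈p∪q⁺ (inj₂ (x∈p∧x∉q⇒x∈p─q (∈-setOf⁺ G (u ~?_) (~-sym v~u)) v∉D))

  bounded : ∀ u → u ∈ D → ∣ closedN u ∣ ≤ suc k
  bounded u u∈D = ℕ.≤-trans (∣p∪q∣≤∣p∣+∣q∣ ⁅ index u ⁆ (N u ─ D))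
    (ℕ.+-mono-≤ (ℕ.≤-reflexive (∣⁅x⁆∣≡1 (index u))) (limited u u∈D))

γᴸ-attained : ∀ k G → ∃ λ D → LimitedDominating G k D × ∣ D ∣ ≡ γᴸ k G
γᴸ-attained k G = proj₁ (proj₂ (minimumLimitedDominating k G))

γᴸ-minimum : ∀ k G D → LimitedDominating G k D → γᴸ k G ≤ ∣ D ∣
γᴸ-minimum k G = proj₂ (proj₂ (minimumLimitedDominating k G))

order≤γᴸ*suc-k : ∀ k G → order G ≤ γᴸ k G * suc k
order≤γᴸ*suc-k k G = let D , ld , ∣D∣≡γ = γᴸ-attained k G in
  subst (λ m → order G ≤ m * suc k) ∣D∣≡γ (order≤∣D∣*suc-k G k D ld)

-- The upper bound.

-- Stated for any graph isomorphic to G □ H, so that it applies to both factors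
-- of a product.
module _ (P G H : Graph) where
  private
    module P = Graph P
    module G = Graph G
    module H = Graph H
    module □ = Graph (G □ H)

  module _ (iso : P.Vertex ↔ □.Vertex)
           (~⇔~ : ∀ {u v} → u P.~ v ⇔ Inverse.to iso u □.~ Inverse.to iso v) where
    open Inverse iso using (to; from; strictlyInverseˡ; strictlyInverseʳ)

    inLayers? : (D : G.VertexSet) → Decidable (λ v → proj₁ (to v) G.∈ D)
    inLayers? D v = proj₁ (to v) G.∈? D

    -- The copy of D × V(H) inside `P`.
    layers : G.VertexSet → P.VertexSet
    layers D = setOf P (inLayers? D)

    -- The fibres of the first coordinate over the members of `D` cover `layers D`, and each fibre
    -- is an image of V(H), hence has at most `order H` elements.
    ∣layers∣≤ : ∀ D → ∣ layers D ∣ ≤ ∣ D ∣ * order H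
    ∣layers∣≤ D = ∣∣-cover G P D (layers D) (λ g → setOf P (layer? g))
      (λ v v∈ → proj₁ (to v) , ∈-setOf⁻ P (inLayers? D) v∈ , ∈-setOf⁺ P (layer? _) refl)
      (λ g _ → subst (∣ setOf P (layer? g) ∣ ≤_) (∣⊤∣≡n (order H))
        (∣∣-image H P ⊤ (setOf P (layer? g)) (λ h → from (g , h))
          (λ v v∈ → proj₂ (to v) , ∈⊤ ,
            trans (cong (λ g′ → from (g′ , proj₂ (to v))) (sym (∈-setOf⁻ P (layer? g) v∈)))
                  (strictlyInverseʳ v))))
      where
      layer? : ∀ g → Decidable (λ v → proj₁ (to v) ≡ g)
      layer? g v = proj₁ (to v) G.≟ᵛ g

    -- A vertex outside is dominated by moving its first coordinate to a dominator in `D` and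
    -- keeping the second. For limitedness, `g′ ↦ (g′ , h)` sends `G.N g ─ D` onto the outside
    -- neighbours of `(g , h)`.
    layers-limitedDominating : ∀ {k} D → LimitedDominating G k D →
                               LimitedDominating P k (layers D)
    layers-limitedDominating {k} D (dominating , limited) = dominating′ , limited′
      where
      dominating′ : Dominating P (layers D)
      dominating′ v v∉ =
        let g , g∈D , v~g = dominating (proj₁ (to v)) (v∉ ∘ ∈-setOf⁺ P (inLayers? D))
            gh = g , proj₂ (to v)
        in from gh
         , ∈-setOf⁺ P (inLayers? D)
             (subst (λ w → proj₁ w G.∈ D) (sym (strictlyInverseˡ gh)) g∈D)
         , Equivalence.from ~⇔~
             (subst (to v □.~_) (sym (strictlyInverseˡ gh)) (inj₂ (refl , v~g)))

      limited′ : ∀ u → u P.∈ layers D → ∣ P.N u ─ layers D ∣ ≤ k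
      limited′ u u∈ = ℕ.≤-trans
        (∣∣-image G P (G.N g ─ D) (P.N u ─ layers D) (λ g′ → from (g′ , h)) onto)
        (limited g g∈D)
        where
        g = proj₁ (to u)
        h = proj₂ (to u)

        g∈D : g G.∈ D
        g∈D = ∈-setOf⁻ P (inLayers? D) u∈

        onto : ∀ v → v P.∈ P.N u ─ layers D →
               ∃ λ g′ → g′ G.∈ G.N g ─ D × from (g′ , h) ≡ v
        onto v v∈ with Equivalence.to ~⇔~
                         (∈-setOf⁻ P (u P.~?_) (p─q⊆p (P.N u) (layers D) v∈))
                     | x∈p─q⇒x∉q (P.N u) (layers D) v∈ ∘ ∈-setOf⁺ P (inLayers? D)
        -- An edge along `H` keeps the first coordinate in `D`, so `v` would lie in `layers D`.
        ... | inj₁ (g≡g′ , _)    | g′∉D = contradiction (subst (G._∈ D) g≡g′ g∈D) g′∉D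
        ... | inj₂ (h≡h′ , g~g′) | g′∉D =
            proj₁ (to v)
          , x∈p∧x∉q⇒x∈p─q (∈-setOf⁺ G (g G.~?_) g~g′) g′∉D
          , trans (cong (λ h′ → from (proj₁ (to v) , h′)) h≡h′) (strictlyInverseʳ v)

    γᴸ≤γᴸ*order : ∀ k → γᴸ k P ≤ γᴸ k G * order H
    γᴸ≤γᴸ*order k = let D , ld , ∣D∣≡γ = γᴸ-attained k G in
      ℕ.≤-trans (γᴸ-minimum k P (layers D) (layers-limitedDominating D ld))
        (subst (λ m → ∣ layers D ∣ ≤ m * order H) ∣D∣≡γ (∣layers∣≤ D))

-- Ceilings of fractions, and the two bounds combined.

ceiling-least : ∀ i j d → i ≤ᶻ j ℤ.* + suc d → ceiling (i / suc d) ≤ᶻ j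
-- The ceiling is defined as minus the floor of `- i / suc d`, so the claim is the negation of
-- `- j ≤ q`.
ceiling-least i j d i≤jd = subst (ceiling (i / suc d) ≤ᶻ_) (ℤ.neg-involutive j)
  (ℤ.neg-mono-≤ -j≤⌊-i/d⌋)
  where
  q = (ℤ.- i) ℤ./ + suc d

  -jd<[1+q]d : (ℤ.- j) ℤ.* + suc d ℤ.< ℤ.suc q ℤ.* + suc d
  -jd<[1+q]d = ℤ.≤-<-trans
    -- The chain is -j(d+1) ≤ -i < (1+q)(d+1), the strict part because the remainder is smaller than
    -- the divisor.
    (subst (_≤ᶻ ℤ.- i) (ℤ.neg-distribˡ-* j (+ suc d)) (ℤ.neg-mono-≤ i≤jd))
    (subst (λ r → ℤ.- i ℤ.< ℤ.suc r ℤ.* + suc d)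
      (sym (ℤ.div-pos-is-/ℕ (ℤ.- i) (suc d))) (ℤ.n<s[n/ℕd]*d (ℤ.- i) (suc d)))

  -j≤⌊-i/d⌋ : ℤ.- j ≤ᶻ q
  -j≤⌊-i/d⌋ = subst (ℤ.- j ≤ᶻ_) (ℤ.pred-suc q)
    -- Cancelling the positive divisor leaves `- j < 1 + q`, which over the integers means
    -- `- j ≤ q`.
    (ℤ.i<j⇒i≤pred[j] (ℤ.*-cancelʳ-<-nonNeg {ℤ.- j} {ℤ.suc q} (+ suc d) -jd<[1+q]d))

theorem7 : (G H : Graph) (k : ℕ) → 1 ≤ k →
    (ceiling (+ (order G * order H) / suc k) ≤ᶻ + γᴸ k (G □ H)) ×
    (γᴸ k (G □ H) ≤ (γᴸ k G * order H) ⊓ (γᴸ k H * order G))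
theorem7 G H k _ =
    ceiling-least _ (+ γᴸ k (G □ H)) k
      (subst (+ order (G □ H) ≤ᶻ_) (ℤ.pos-* (γᴸ k (G □ H)) (suc k))
        (ℤ.+≤+ (order≤γᴸ*suc-k k (G □ H))))
  , ℕ.⊓-glb
      (γᴸ≤γᴸ*order (G □ H) G H ↔-refl (mk⇔ id id) k)
      -- Exchanging coordinates identifies G □ H with H □ G; on adjacency this swaps the two
      -- disjuncts.
      (γᴸ≤γᴸ*order (G □ H) H G (×-comm _ _) (mk⇔ swap swap) k)
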